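{- Let $d=d_n$ be a sequence of positive integers such that $\frac{d_n}{\log n}\to\infty$. For each $n$, let $G_n$ be a $d_n$-regular graph of order $n$. Then the size of a maximum matching in $G_n$ is $\left(\frac12-o(1)\right)n$ as $n\to\infty$.
   Context: Graphs are finite and simple; the order of a graph is its number of vertices, and the size of a matching is its number of edges. It is assumed that $d_n n$ is even (so when $d$ is odd the limit is taken over even values of $n$). $\log$ is the natural logarithm, and $o(1)$ denotes a quantity tending to $0$ as $n\to\infty$. -}

module Defs where

open import Data.Fin using (Fin)
open import Data.Integer using (+_)
open import Data.List using (List; allFin; applyUpTo; filter; foldr; length)
open import Data.List.Relation.Unary.All using (All)
open import Data.List.Relation.Unary.AllPairs using (AllPairs)
open import Data.Nat as ℕ using (ℕ; suc)
open import Data.Nat.Divisibility using (_∣_)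
open import Data.Product using (_×_; _,_; ∃-syntax; uncurry)
open import Data.Rational as ℚ using (ℚ; 0ℚ; _/_)
open import Level using (0ℓ)
open import Relation.Binary using (Rel; Decidable; Symmetric)
open import Relation.Binary.PropositionalEquality using (_≡_; _≢_)
open import Relation.Nullary using (¬_)

record Graph (n : ℕ) : Set₁ where
  infix 4 _~_ _~?_
  field
    _~_      : Rel (Fin n) 0ℓ
    _~?_     : Decidable _~_
    ~-sym    : Symmetric _~_
    ~-irrefl : ∀ v → ¬ (v ~ v)

  degree : Fin n → ℕ
  degree v = length (filter (v ~?_) (allFin n))

Regular : ∀ {n} → ℕ → Graph n → Set
Regular d G = ∀ v → Graph.degree G v ≡ d

VertexDisjoint : ∀ {n} → Rel (Fin n × Fin n) 0ℓ
VertexDisjoint (a , b) (c , d) = a ≢ c × a ≢ d × b ≢ c × b ≢ d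

-- An edge is listed once, with an arbitrary orientation: neither an edge nor
-- its reversal is vertex-disjoint from the edge itself, so the length of the
-- list is the number of edges.
record Matching {n : ℕ} (G : Graph n) : Set where
  field
    edges    : List (Fin n × Fin n)
    areEdges : All (uncurry (Graph._~_ G)) edges
    disjoint : AllPairs VertexDisjoint edges

  size : ℕ
  size = length edges

-- Any two maximum matchings of G have the same size, by antisymmetry of ≤.
IsMaximum : ∀ {n} {G : Graph n} → Matching G → Set
IsMaximum {G = G} M = (M′ : Matching G) → Matching.size M′ ℕ.≤ Matching.size M

ℕ→ℚ : ℕ → ℚ
ℕ→ℚ m = + m / 1

-- The lower Darboux sum of log n = ∫₁ⁿ dt/t for the partition of [1 , n] into
-- intervals of width 1/s (s ≥ 1): the interval with right endpoint
-- (s + i + 1)/s contributes (1/s) · s/(s + i + 1), for 0 ≤ i < (n - 1)s.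
-- It is the empty sum for s = 0.
logLowerSum : ℕ → ℕ → ℚ
logLowerSum n s =
  foldr ℚ._+_ 0ℚ (applyUpTo (λ i → + 1 / suc (s ℕ.+ i)) ((n ℕ.∸ 1) ℕ.* s))

-- K · log n ≤ x for the natural logarithm and n ≥ 1, where the real number
-- log n is the supremum over s of its lower Darboux sums.
_*log_≤_ : ℕ → ℕ → ℚ → Set
K *log n ≤ x = ∀ s → ℕ→ℚ K ℚ.* logLowerSum n s ℚ.≤ x

-- Limits as n → ∞ are taken along the n satisfying a predicate I.
EventuallyAlong : (I P : ℕ → Set) → Set
EventuallyAlong I P = ∃[ N ] (∀ n → N ℕ.≤ n → I n → P n)

-- d n / log n → ∞, with d n / log n ≥ K cleared of its denominator.
RatioToLog→∞Along : (I : ℕ → Set) → (ℕ → ℕ) → Set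
RatioToLog→∞Along I d = ∀ K → EventuallyAlong I (λ n → K *log n ≤ ℕ→ℚ (d n))

Tends→0Along : (I : ℕ → Set) → (ℕ → ℚ) → Set
Tends→0Along I o =
  ∀ ε → 0ℚ ℚ.< ε → EventuallyAlong I (λ n → ℚ.∣ o n ∣ ℚ.< ε)

-- The n for which the parity condition for a d n-regular graph of order n
-- holds: where d n is odd, n must be even.
Admissible : (ℕ → ℕ) → ℕ → Set
Admissible d n = 2 ∣ d n ℕ.* n

{-# OPTIONS --safe #-}
-- A maximum matching of a d-regular graph of order n leaves at most n/(d + 1)
-- vertices unmatched. Delete vertices covered by every maximum matching of
-- what is left, until there are none; let S be the set of deleted vertices.
-- By Gallai's lemma, "no maximum matching of G − S misses both u and v" is then
-- an equivalence relation, and adjacent vertices are equivalent. A maximum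
-- matching f of G − S misses at most one vertex of each class, while a class
-- either has at least d + 1 vertices or sends at least d edges into S, which
-- receives at most d |S| edges. Hence f misses at most |S| + n/(d + 1) vertices
-- outside S, and a maximum matching of G misses |S| fewer than that.
--
-- Finally d tends to infinity along with d / log n, because log n ≥ 1/2 for n ≥ 2.
module Submission where

open import Data.Bool using (if_then_else_)
open import Data.Fin as Fin using (Fin; zero; suc; _≟_)
open import Data.Fin.Permutation using (permutation)
import Data.Fin.Properties as Fin
open import Data.Integer as ℤ using ()
import Data.Integer.Properties as ℤ
import Data.Integer.Solver as ℤ
open import Data.List as List using (List; []; _∷_; allFin; applyUpTo; filter; foldr; length; tabulate)
import Data.List.Membership.DecPropositional as DecMembership
open import Data.List.Membership.Propositional using (_∈_; _∉_)
import Data.List.Properties as List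
open import Data.List.Relation.Unary.All as All using (All; []; _∷_)
import Data.List.Relation.Unary.All.Properties as All
open import Data.List.Relation.Unary.AllPairs using (AllPairs; []; _∷_)
import Data.List.Relation.Unary.AllPairs.Properties as AllPairs
open import Data.List.Relation.Unary.Any using (here; there)
open import Data.Nat as ℕ using (ℕ; zero; suc; _+_; _*_; _∸_; _≤_; _<_; z≤n; s≤s)
open import Data.Nat.Properties hiding (_≟_)
import Data.Nat.Solver as ℕ
open import Data.Product using (_×_; _,_; ∃; ∃-syntax; proj₁; proj₂; uncurry)
open import Data.Rational as ℚ using (ℚ; mkℚ; 0ℚ; ½; _/_; ↧ₙ_)
import Data.Rational.Properties as ℚ
open import Data.Rational.Unnormalised as ℚᵘ using (mkℚᵘ)
import Data.Rational.Unnormalised.Properties as ℚᵘ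
open import Data.Sum as Sum using (_⊎_; inj₁; inj₂)
open import Data.Vec.Functional as Vector using ()
open import Function using (_∘_; id; case_of_)
open import Level using (0ℓ)
open import Relation.Binary using (Rel; Decidable; Symmetric; tri<; tri≈; tri>)
open import Relation.Binary.PropositionalEquality
open import Relation.Nullary using (Dec; yes; no; does; ¬_; ¬?; contradiction; _×-dec_; _→-dec_)
open import Relation.Nullary.Decidable using (map′; decidable-stable)
open import Algebra.Properties.Semiring.Sum +-*-semiring
  using (sum; sum-cong-≗; ∑-distrib-+; ∑-comm; sum-permute; *-distribˡ-sum; *-distribʳ-sum)
open import Defs

private
  open module Mem {n} = DecMembership (_≟_ {n}) using (_∈?_)

-- Indicator functions and counting in finite sets.

𝟙 : ∀ {P : Set} → Dec P → ℕ
𝟙 P? = if does P? then 1 else 0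

𝟙-yes : ∀ {P : Set} (P? : Dec P) → P → 𝟙 P? ≡ 1
𝟙-yes (yes _) _ = refl
𝟙-yes (no ¬p) p = contradiction p ¬p

𝟙-no : ∀ {P : Set} (P? : Dec P) → ¬ P → 𝟙 P? ≡ 0
𝟙-no (yes p) ¬p = contradiction p ¬p
𝟙-no (no _)  _  = refl

𝟙-mono : ∀ {P Q : Set} (P? : Dec P) (Q? : Dec Q) → (P → Q) → 𝟙 P? ≤ 𝟙 Q?
𝟙-mono (yes p) Q? f = ≤-reflexive (sym (𝟙-yes Q? (f p)))
𝟙-mono (no _)  Q? f = z≤n

count : ∀ {n} {P : Fin n → Set} → (∀ i → Dec (P i)) → ℕ
count P? = sum (λ i → 𝟙 (P? i))

sum-mono : ∀ {n} {f g : Fin n → ℕ} → (∀ i → f i ≤ g i) → sum f ≤ sum g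
sum-mono {zero}  f≤g = z≤n
sum-mono {suc n} f≤g = +-mono-≤ (f≤g zero) (sum-mono (f≤g ∘ suc))

sum-const : ∀ n c → sum {n} (λ _ → c) ≡ n * c
sum-const zero    c = refl
sum-const (suc n) c = cong (c +_) (sum-const n c)

count-≟ : ∀ {n} (a : Fin n) → count (λ i → i ≟ a) ≡ 1
count-≟ {suc n} zero    = cong suc (trans (sum-const n 0) (*-zeroʳ n))
count-≟ {suc n} (suc a) = count-≟ a

count-unique : ∀ {n} {P : Fin n → Set} (P? : ∀ i → Dec (P i)) →
               (∀ {i j} → P i → P j → i ≡ j) → count P? ≤ 1
count-unique {zero}  P? unique = z≤n
count-unique {suc n} P? unique with P? zero
... | no  _  = count-unique (P? ∘ suc) (λ p q → Fin.suc-injective (unique p q))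
... | yes p₀ = s≤s (≤-reflexive (trans (sum-cong-≗ (λ i → 𝟙-no (P? (suc i)) (λ p → case unique p₀ p of λ ())))
                                       (trans (sum-const n 0) (*-zeroʳ n))))

1≤count : ∀ {n} {P : Fin n → Set} (P? : ∀ i → Dec (P i)) → ∀ i → P i → 1 ≤ count P?
1≤count P? i p = begin
  1                    ≡⟨ count-≟ i ⟨
  count (λ j → j ≟ i)  ≤⟨ sum-mono (λ j → 𝟙-mono (j ≟ i) (P? j) (λ { refl → p })) ⟩
  count P?             ∎
  where open ≤-Reasoning

length-filter-tabulate : ∀ {A : Set} {P : A → Set} (P? : ∀ x → Dec (P x)) {n} (f : Fin n → A) →
                         length (filter P? (tabulate f)) ≡ count (P? ∘ f)
length-filter-tabulate P? {zero}  f = refl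
length-filter-tabulate P? {suc n} f with P? (f zero)
... | yes _ = cong suc (length-filter-tabulate P? (f ∘ suc))
... | no  _ = length-filter-tabulate P? (f ∘ suc)

-- Exhaustive search over functions and least witnesses.

-- The values are searched one argument at a time. A function reassembled from its head and tail
-- agrees with the original only pointwise, hence the congruence hypothesis on `P`.
anyFunction? : ∀ {m n} {P : (Fin m → Fin n) → Set} → (∀ f → Dec (P f)) →
               (∀ {f g} → f ≗ g → P f → P g) → Dec (∃ P)
anyFunction? {zero}  P? resp = map′ (_ ,_) (λ (f , p) → resp (λ ()) p) (P? (λ ()))
anyFunction? {suc m} P? resp =
  map′ (λ (i , g , p) → _ , p)
       (λ (f , p) → f zero , f ∘ suc , resp (λ { zero → refl ; (suc _) → refl }) p)
       (Fin.any? λ i → anyFunction? (λ g → P? (i Vector.∷ g))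
                     (λ g≗h → resp (λ { zero → refl ; (suc j) → g≗h j })))

leastℕ : ∀ {P : ℕ → Set} → (∀ k → Dec (P k)) → ∃ P → ∃[ k ] P k × (∀ {j} → P j → k ≤ j)
leastℕ {P} P? (k , p) = search k (subst P (sym (+-identityʳ k)) p) (λ _ → z≤n) where
  -- `i` is the candidate and `j` the fuel; `j + i` never changes, so `P` holds at the candidate
  -- when the fuel is spent.
  search : ∀ j {i} → P (j + i) → (∀ {l} → P l → i ≤ l) → ∃[ k ] P k × (∀ {j} → P j → k ≤ j)
  search zero    {i} p lower = i , p , lower
  search (suc j) {i} p lower with P? i
  ... | yes q = i , q , lower
  ... | no ¬q = search j (subst P (sym (+-suc j i)) p)
                  (λ {l} r → ≤∧≢⇒< (lower r) (λ { refl → ¬q r }))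

-- Updating a function at one point.

infixl 20 _[_↦_]

opaque
  -- Opaque, so that later proofs see an update only through `↦-hit` and `↦-miss`, and splits on
  -- `_≟_` leave it folded.
  _[_↦_] : ∀ {n} → (Fin n → Fin n) → Fin n → Fin n → Fin n → Fin n
  (f [ x ↦ y ]) z = if does (z ≟ x) then y else f z

  ↦-hit : ∀ {n} (f : Fin n → Fin n) x y → (f [ x ↦ y ]) x ≡ y
  ↦-hit f x y with x ≟ x
  ... | yes _  = refl
  ... | no x≢x = contradiction refl x≢x

  ↦-miss : ∀ {n} (f : Fin n → Fin n) x y {z} → z ≢ x → (f [ x ↦ y ]) z ≡ f z
  ↦-miss f x y {z} z≢x with z ≟ x
  ... | yes z≡x = contradiction z≡x z≢x
  ... | no _    = refl

unmatched : ∀ {n} → (Fin n → Fin n) → ℕ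
unmatched f = count (λ x → f x ≟ x)

-- Only the contribution of `x` changes. The old and new indicators stand on opposite sides to avoid
-- subtraction.
unmatched-↦ : ∀ {n} (f : Fin n → Fin n) x y →
              unmatched (f [ x ↦ y ]) + 𝟙 (f x ≟ x) ≡ unmatched f + 𝟙 (y ≟ x)
unmatched-↦ f x y = begin
  unmatched g + 𝟙 (f x ≟ x)                          ≡⟨ cong (unmatched g +_) (pick (𝟙 (f x ≟ x))) ⟨
  unmatched g + sum (λ z → 𝟙 (z ≟ x) * 𝟙 (f x ≟ x))  ≡⟨ ∑-distrib-+ (λ z → 𝟙 (g z ≟ z)) _ ⟨
  sum (λ z → 𝟙 (g z ≟ z) + 𝟙 (z ≟ x) * 𝟙 (f x ≟ x))  ≡⟨ sum-cong-≗ pointwise ⟩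
  sum (λ z → 𝟙 (f z ≟ z) + 𝟙 (z ≟ x) * 𝟙 (y ≟ x))    ≡⟨ ∑-distrib-+ (λ z → 𝟙 (f z ≟ z)) _ ⟩
  unmatched f + sum (λ z → 𝟙 (z ≟ x) * 𝟙 (y ≟ x))    ≡⟨ cong (unmatched f +_) (pick (𝟙 (y ≟ x))) ⟩
  unmatched f + 𝟙 (y ≟ x)                            ∎
  where
  open ≡-Reasoning
  g = f [ x ↦ y ]
  pick : ∀ c → sum (λ z → 𝟙 (z ≟ x) * c) ≡ c
  pick c = trans (sym (*-distribʳ-sum c (λ z → 𝟙 (z ≟ x)))) (trans (cong (_* c) (count-≟ x)) (*-identityˡ c))
  pointwise : ∀ z → 𝟙 (g z ≟ z) + 𝟙 (z ≟ x) * 𝟙 (f x ≟ x) ≡ 𝟙 (f z ≟ z) + 𝟙 (z ≟ x) * 𝟙 (y ≟ x)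
  pointwise z with z ≟ x
  ... | no  z≢x  = cong (λ w → 𝟙 (w ≟ z) + 0) (↦-miss f x y z≢x)
  ... | yes refl = trans (cong₂ (λ w → 𝟙 (w ≟ x) +_) (↦-hit f x y) (*-identityˡ _))
                   (trans (+-comm (𝟙 (y ≟ x)) _) (cong (𝟙 (f x ≟ x) +_) (sym (*-identityˡ _))))

unmatched-cong : ∀ {n} {f g : Fin n → Fin n} → f ≗ g → unmatched f ≡ unmatched g
unmatched-cong f≗g = sum-cong-≗ (λ x → cong (λ y → 𝟙 (y ≟ x)) (f≗g x))

-- Matchings as involutions.

-- A matching is encoded by the involution that exchanges the ends of each of
-- its edges and fixes the unmatched vertices.
record IsMatching {n} (E : Rel (Fin n) 0ℓ) (f : Fin n → Fin n) : Set where
  field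
    involutive : ∀ x → f (f x) ≡ x
    edge       : ∀ x → f x ≢ x → E x (f x)

open IsMatching

pairs : ∀ {n} → (Fin n → Fin n) → ℕ
pairs f = count (λ x → x Fin.<? f x)

module _ {n} {E : Rel (Fin n) 0ℓ} where

  -- A vertex is fixed, below its partner or above it, and `f` itself is a bijection between the
  -- lower and the upper ends.
  unmatched+2pairs : ∀ {f} → IsMatching E f → unmatched f + 2 * pairs f ≡ n
  unmatched+2pairs {f} M = begin
    unmatched f + 2 * pairs f
      ≡⟨ cong (λ k → unmatched f + (pairs f + k)) (+-identityʳ (pairs f)) ⟩
    unmatched f + (pairs f + pairs f)               ≡⟨ cong (λ k → unmatched f + (pairs f + k)) swapped ⟩
    unmatched f + (pairs f + count >?)              ≡⟨ cong (unmatched f +_) (∑-distrib-+ (𝟙 ∘ <?) (𝟙 ∘ >?)) ⟨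
    unmatched f + sum (λ x → 𝟙 (<? x) + 𝟙 (>? x))   ≡⟨ ∑-distrib-+ (𝟙 ∘ ≡?) _ ⟨
    sum (λ x → 𝟙 (≡? x) + (𝟙 (<? x) + 𝟙 (>? x)))    ≡⟨ sum-cong-≗ trichotomy ⟩
    sum {n} (λ _ → 1)                               ≡⟨ trans (sum-const n 1) (*-identityʳ n) ⟩
    n                                               ∎
    where
    open ≡-Reasoning
    ≡? : ∀ x → Dec (f x ≡ x)
    ≡? x = f x ≟ x
    <? : ∀ x → Dec (x Fin.< f x)
    <? x = x Fin.<? f x
    >? : ∀ x → Dec (f x Fin.< x)
    >? x = f x Fin.<? x
    swapped : pairs f ≡ count >?
    swapped = trans (sum-permute _ (permutation f f (involutive M) (involutive M)))
                (sum-cong-≗ (λ x → cong (λ y → 𝟙 (f x Fin.<? y)) (involutive M x)))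
    trichotomy : ∀ x → 𝟙 (≡? x) + (𝟙 (<? x) + 𝟙 (>? x)) ≡ 1
    trichotomy x with Fin.<-cmp x (f x)
    ... | tri< a ¬b ¬c = cong₂ _+_ (𝟙-no (≡? x) (¬b ∘ sym)) (cong₂ _+_ (𝟙-yes (<? x) a) (𝟙-no (>? x) ¬c))
    ... | tri≈ ¬a b ¬c = cong₂ _+_ (𝟙-yes (≡? x) (sym b)) (cong₂ _+_ (𝟙-no (<? x) ¬a) (𝟙-no (>? x) ¬c))
    ... | tri> ¬a ¬b c = cong₂ _+_ (𝟙-no (≡? x) (¬b ∘ sym)) (cong₂ _+_ (𝟙-no (<? x) ¬a) (𝟙-yes (>? x) c))

  -- By `unmatched+2pairs` both numbers have the parity of `n`.
  unmatched-gap : ∀ {f g} → IsMatching E f → IsMatching E g →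
                  unmatched f < unmatched g → 2 + unmatched f ≤ unmatched g
  unmatched-gap {f} {g} M N f<g = +-cancelʳ-≤ (2 * pairs g) _ _ (begin
    2 + unmatched f + 2 * pairs g
      ≡⟨ solve 2 (λ a q → con 2 :+ a :+ con 2 :* q := a :+ con 2 :* (con 1 :+ q)) refl (unmatched f) (pairs g) ⟩
    unmatched f + 2 * suc (pairs g)  ≤⟨ +-monoʳ-≤ (unmatched f) (*-monoʳ-≤ 2 q<p) ⟩
    unmatched f + 2 * pairs f        ≡⟨ trans (unmatched+2pairs M) (sym (unmatched+2pairs N)) ⟩
    unmatched g + 2 * pairs g        ∎)
    where
    open ≤-Reasoning
    open ℕ.+-*-Solver
    q<p : pairs g < pairs f
    q<p = ≰⇒> λ p≤q → <⇒≢ (+-mono-<-≤ f<g (*-monoʳ-≤ 2 p≤q))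
                         (trans (unmatched+2pairs M) (sym (unmatched+2pairs N)))

  id-isMatching : IsMatching E id
  id-isMatching = record { involutive = λ _ → refl ; edge = λ x x≢x → contradiction refl x≢x }

  isMatching-cong : ∀ {f g} → f ≗ g → IsMatching E f → IsMatching E g
  isMatching-cong {f} {g} f≗g M = record
    { involutive = λ x → trans (sym (f≗g (g x))) (trans (cong f (sym (f≗g x))) (involutive M x))
    ; edge       = λ x gx≢x → subst (E x) (f≗g x) (edge M x (gx≢x ∘ trans (sym (f≗g x))))
    }

  isMatching? : Decidable E → ∀ f → Dec (IsMatching E f)
  isMatching? E? f =
    map′ (λ (i , e) → record { involutive = i ; edge = e }) (λ M → involutive M , edge M)
      (Fin.all? (λ x → f (f x) ≟ x) ×-dec Fin.all? (λ x → ¬? (f x ≟ x) →-dec E? x (f x)))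

-- Maximum matchings: existence and decidability.

-- By `unmatched+2pairs`, fewest unmatched vertices means most edges.
record Maximum {n} (E : Rel (Fin n) 0ℓ) (f : Fin n → Fin n) : Set where
  field
    isMatching : IsMatching E f
    least      : ∀ {g} → IsMatching E g → unmatched f ≤ unmatched g

open Maximum

≤-maximum : ∀ {n} {E : Rel (Fin n) 0ℓ} {f g} → Maximum E f → IsMatching E g →
            unmatched g ≤ unmatched f → Maximum E g
≤-maximum F G g≤f = record { isMatching = G ; least = λ H → ≤-trans g≤f (least F H) }

module _ {n} {E : Rel (Fin n) 0ℓ} (E? : Decidable E) where

  -- The given `F` turns maximality of a candidate `g` into the single comparison
  -- `unmatched g ≤ unmatched f`.
  unmatchedPair? : ∀ {f} → Maximum E f → ∀ u v → Dec (∃[ g ] Maximum E g × g u ≡ u × g v ≡ v)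
  unmatchedPair? {f} F u v =
    map′ (λ (g , (G , g≤f) , gu , gv) → g , ≤-maximum F G g≤f , gu , gv)
         (λ (g , G , gu , gv) → g , (isMatching G , least G (isMatching F)) , gu , gv)
         (anyFunction?
           (λ g → (isMatching? E? g ×-dec unmatched g ≤? unmatched f) ×-dec (g u ≟ u ×-dec g v ≟ v))
           (λ g≗h ((G , g≤f) , gu , gv) →
             (isMatching-cong g≗h G , subst (_≤ _) (unmatched-cong g≗h) g≤f) ,
             trans (sym (g≗h u)) gu , trans (sym (g≗h v)) gv))

  maximum : ∃ (Maximum E)
  maximum with leastℕ (λ k → anyFunction? (λ f → isMatching? E? f ×-dec unmatched f ℕ.≟ k)
                        (λ f≗g (F , eq) → isMatching-cong f≗g F , trans (sym (unmatched-cong f≗g)) eq))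
                      (_ , id , id-isMatching , refl)
  ... | _ , (f , F , refl) , lower = f , record { isMatching = F ; least = λ G → lower (_ , G , refl) }

-- Local changes of a matching.

link : ∀ {n} → Fin n → Fin n → (Fin n → Fin n) → Fin n → Fin n
link v a f = f [ v ↦ a ] [ a ↦ v ]

-- Frees v, whose partner a moves to the unmatched vertex b.
slide : ∀ {n} → Fin n → Fin n → Fin n → (Fin n → Fin n) → Fin n → Fin n
slide v a b f = f [ v ↦ v ] [ a ↦ b ] [ b ↦ a ]

module _ {n} {E : Rel (Fin n) 0ℓ} (E-sym : Symmetric E) where

  module _ {v a f} (F : IsMatching E f) (v≢a : v ≢ a) (fv : f v ≡ v) (fa : f a ≡ a) (e : E v a) where
    private
      g = link v a f
      g-a : g a ≡ v
      g-a = ↦-hit _ a v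
      g-v : g v ≡ a
      g-v = trans (↦-miss _ a v v≢a) (↦-hit f v a)

    link-else : ∀ {x} → x ≢ v → x ≢ a → link v a f x ≡ f x
    link-else x≢v x≢a = trans (↦-miss _ a v x≢a) (↦-miss f v a x≢v)

    link-isMatching : IsMatching E (link v a f)
    link-isMatching = record { involutive = inv ; edge = edg }
      where
      inv : ∀ x → g (g x) ≡ x
      inv x with x ≟ v | x ≟ a
      ... | yes refl | _        = trans (cong g g-v) g-a
      ... | no _     | yes refl = trans (cong g g-a) g-v
      ... | no x≢v   | no x≢a   =
        trans (cong g (link-else x≢v x≢a)) (trans (link-else fx≢v fx≢a) (involutive F x))
        where
        fx≢v : f x ≢ v
        fx≢v eq = x≢v (trans (sym (involutive F x)) (trans (cong f eq) fv))
        fx≢a : f x ≢ a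
        fx≢a eq = x≢a (trans (sym (involutive F x)) (trans (cong f eq) fa))
      edg : ∀ x → g x ≢ x → E x (g x)
      edg x gx≢x with x ≟ v | x ≟ a
      ... | yes refl | _        = subst (E v) (sym g-v) e
      ... | no _     | yes refl = subst (E a) (sym g-a) (E-sym e)
      ... | no x≢v   | no x≢a   =
        subst (E x) (sym (link-else x≢v x≢a)) (edge F x (gx≢x ∘ trans (link-else x≢v x≢a)))

    unmatched-link : 2 + unmatched (link v a f) ≡ unmatched f
    unmatched-link = begin
      2 + unmatched g                ≡⟨ +-comm 2 _ ⟩
      unmatched g + 2                ≡⟨ +-assoc (unmatched g) 1 1 ⟨
      unmatched g + 1 + 1            ≡⟨ cong (λ k → unmatched g + k + 1) (𝟙-yes (h a ≟ a) ha) ⟨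
      unmatched g + 𝟙 (h a ≟ a) + 1  ≡⟨ cong (_+ 1) (unmatched-↦ h a v) ⟩
      unmatched h + 𝟙 (v ≟ a) + 1    ≡⟨ cong (λ k → unmatched h + k + 1) (𝟙-no (v ≟ a) v≢a) ⟩
      unmatched h + 0 + 1            ≡⟨ cong (_+ 1) (+-identityʳ _) ⟩
      unmatched h + 1                ≡⟨ cong (unmatched h +_) (𝟙-yes (f v ≟ v) fv) ⟨
      unmatched h + 𝟙 (f v ≟ v)      ≡⟨ unmatched-↦ f v a ⟩
      unmatched f + 𝟙 (a ≟ v)        ≡⟨ cong (unmatched f +_) (𝟙-no (a ≟ v) (v≢a ∘ sym)) ⟩
      unmatched f + 0                ≡⟨ +-identityʳ _ ⟩
      unmatched f                    ∎
      where
      open ≡-Reasoning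
      h = f [ v ↦ a ]
      ha : h a ≡ a
      ha = trans (↦-miss f v a (v≢a ∘ sym)) fa

  -- Otherwise `link` would lower the number of unmatched vertices by two.
  noAugmentingEdge : ∀ {v a f} → Maximum E f → v ≢ a → f v ≡ v → f a ≡ a → ¬ E v a
  noAugmentingEdge F v≢a fv fa e =
    m+1+n≰m _ (≤-trans (≤-reflexive (trans (+-comm _ 2) (unmatched-link (isMatching F) v≢a fv fa e)))
                       (least F (link-isMatching (isMatching F) v≢a fv fa e)))

  module _ {v a b f} (F : IsMatching E f) (v≢a : v ≢ a) (fv : f v ≡ a)
           (v≢b : v ≢ b) (fb : f b ≡ b) (e : E a b) where
    private
      g = slide v a b f
      fa : f a ≡ v
      fa = trans (cong f (sym fv)) (involutive F v)
      a≢b : a ≢ b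
      a≢b refl = v≢a (trans (sym fa) fb)

    slide-b : slide v a b f b ≡ a
    slide-b = ↦-hit _ b a

    slide-a : slide v a b f a ≡ b
    slide-a = trans (↦-miss _ b a a≢b) (↦-hit _ a b)

    slide-v : slide v a b f v ≡ v
    slide-v = trans (↦-miss _ b a v≢b) (trans (↦-miss _ a b v≢a) (↦-hit f v v))

    slide-else : ∀ {x} → x ≢ v → x ≢ a → x ≢ b → slide v a b f x ≡ f x
    slide-else x≢v x≢a x≢b = trans (↦-miss _ b a x≢b) (trans (↦-miss _ a b x≢a) (↦-miss f v v x≢v))

    slide-unmatched : ∀ {x} → f x ≡ x → x ≢ b → slide v a b f x ≡ x
    slide-unmatched fx x≢b =
      trans (slide-else (λ { refl → v≢a (trans (sym fx) fv) }) (λ { refl → v≢a (trans (sym fa) fx) }) x≢b) fx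

    slide-isMatching : IsMatching E (slide v a b f)
    slide-isMatching = record { involutive = inv ; edge = edg }
      where
      inv : ∀ x → g (g x) ≡ x
      inv x with x ≟ v | x ≟ a | x ≟ b
      ... | yes refl | _        | _        = trans (cong g slide-v) slide-v
      ... | no _     | yes refl | _        = trans (cong g slide-a) slide-b
      ... | no _     | no _     | yes refl = trans (cong g slide-b) slide-a
      ... | no x≢v   | no x≢a   | no x≢b   =
        trans (cong g (slide-else x≢v x≢a x≢b))
          (trans (slide-else (λ eq → x≢a (back eq fv)) (λ eq → x≢v (back eq fa)) (λ eq → x≢b (back eq fb)))
                 (involutive F x))
        where
        back : ∀ {y z} → f x ≡ y → f y ≡ z → x ≡ z
        back fx fy = trans (sym (involutive F x)) (trans (cong f fx) fy)
      edg : ∀ x → g x ≢ x → E x (g x)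
      edg x gx≢x with x ≟ v | x ≟ a | x ≟ b
      ... | yes refl | _        | _        = contradiction slide-v gx≢x
      ... | no _     | yes refl | _        = subst (E a) (sym slide-a) e
      ... | no _     | no _     | yes refl = subst (E b) (sym slide-b) (E-sym e)
      ... | no x≢v   | no x≢a   | no x≢b   =
        subst (E x) (sym (slide-else x≢v x≢a x≢b)) (edge F x (gx≢x ∘ trans (slide-else x≢v x≢a x≢b)))

    unmatched-slide : unmatched (slide v a b f) ≡ unmatched f
    unmatched-slide = suc-injective (begin
      1 + unmatched g                  ≡⟨ +-comm 1 _ ⟩
      unmatched g + 1                  ≡⟨ cong (unmatched g +_) (𝟙-yes (h b ≟ b) hb) ⟨
      unmatched g + 𝟙 (h b ≟ b)        ≡⟨ unmatched-↦ h b a ⟩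
      unmatched h + 𝟙 (a ≟ b)          ≡⟨ cong (unmatched h +_) (𝟙-no (a ≟ b) a≢b) ⟩
      unmatched h + 0                  ≡⟨ cong (unmatched h +_) (𝟙-no (k a ≟ a) ka≢a) ⟨
      unmatched h + 𝟙 (k a ≟ a)        ≡⟨ unmatched-↦ k a b ⟩
      unmatched k + 𝟙 (b ≟ a)          ≡⟨ cong (unmatched k +_) (𝟙-no (b ≟ a) (a≢b ∘ sym)) ⟩
      unmatched k + 0
        ≡⟨ cong (unmatched k +_) (𝟙-no (f v ≟ v) (λ eq → v≢a (trans (sym eq) fv))) ⟨
      unmatched k + 𝟙 (f v ≟ v)        ≡⟨ unmatched-↦ f v v ⟩
      unmatched f + 𝟙 (v ≟ v)          ≡⟨ cong (unmatched f +_) (𝟙-yes (v ≟ v) refl) ⟩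
      unmatched f + 1                  ≡⟨ +-comm _ 1 ⟩
      1 + unmatched f                  ∎)
      where
      open ≡-Reasoning
      k = f [ v ↦ v ]
      h = k [ a ↦ b ]
      hb : h b ≡ b
      hb = trans (↦-miss k a b (a≢b ∘ sym)) (trans (↦-miss f v v (v≢b ∘ sym)) fb)
      ka≢a : k a ≢ a
      ka≢a eq = v≢a (trans (sym fa) (trans (sym (↦-miss f v v (v≢a ∘ sym))) eq))

  slide-maximum : ∀ {v a b f} → Maximum E f → v ≢ a → f v ≡ a → v ≢ b → f b ≡ b → E a b →
                  Maximum E (slide v a b f)
  slide-maximum F v≢a fv v≢b fb e = record
    { isMatching = slide-isMatching (isMatching F) v≢a fv v≢b fb e
    ; least      = λ G → subst (_≤ _) (sym (unmatched-slide (isMatching F) v≢a fv v≢b fb e)) (least F G) }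

  -- Gallai's lemma.

  difference : (Fin n → Fin n) → (Fin n → Fin n) → ℕ
  difference f g = count (λ x → ¬? (f x ≟ g x))

  -- The last component confines `h` to edges of `f` and `g`; it strengthens Gallai's lemma for an
  -- induction on `difference`.
  Exchange : (Fin n → Fin n) → (Fin n → Fin n) → Fin n → Fin n → Fin n → Set
  Exchange f g u v w =
    ∃[ h ] Maximum E h × h v ≡ v × (h u ≡ u ⊎ h w ≡ w) × (∀ x → h x ≡ x ⊎ h x ≡ f x ⊎ h x ≡ g x)

  -- The alternating path of f and g that starts at v with v —f— a —g— b is
  -- shortened by sliding g to g′ ∋ va, which misses b. A matching h that results
  -- for g′ stays inside f ∪ g′, so it contains va and can be slid back to free v.
  exchange : ∀ k {f g u v w} → Maximum E f → Maximum E g → difference f g < k →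
             u ≢ w → f u ≡ u → f w ≡ w → g v ≡ v →
             Exchange f g u v w
  exchange (suc k) {f} {g} {u} {v} {w} F G (s≤s diff) u≢w fu fw gv with f v ≟ v
  ... | yes fv = f , F , fv , inj₁ fu , λ _ → inj₂ (inj₁ refl)
  ... | no fv≢v = exchanged
    where
    a = f v
    fa : f a ≡ v
    fa = involutive (isMatching F) v
    v≢a : v ≢ a
    v≢a = fv≢v ∘ sym
    b = g a
    -- Were `a` unmatched in `g` as well, the edge `va` of `f` would augment `g`.
    ga≢a : g a ≢ a
    ga≢a ga = noAugmentingEdge G v≢a gv ga (edge (isMatching F) v fv≢v)
    gb : g b ≡ a
    gb = involutive (isMatching G) a
    v≢b : v ≢ b
    v≢b v≡b = fv≢v (trans (sym gb) (trans (cong g (sym v≡b)) gv))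
    a-b : E a b
    a-b = edge (isMatching G) a ga≢a
    g′ = slide b a v g
    a-v : E a v
    a-v = E-sym (edge (isMatching F) v fv≢v)
    G′ : Maximum E g′
    G′ = slide-maximum G ga≢a gb (v≢b ∘ sym) gv a-v
    g′b : g′ b ≡ b
    g′b = slide-v (isMatching G) ga≢a gb (v≢b ∘ sym) gv a-v
    g′a : g′ a ≡ v
    g′a = slide-a (isMatching G) ga≢a gb (v≢b ∘ sym) gv a-v
    g′v : g′ v ≡ a
    g′v = slide-b (isMatching G) ga≢a gb (v≢b ∘ sym) gv a-v
    g′-else : ∀ {x} → x ≢ v → x ≢ a → x ≢ b → g′ x ≡ g x
    g′-else x≢v x≢a x≢b = slide-else (isMatching G) ga≢a gb (v≢b ∘ sym) gv a-v x≢b x≢a x≢v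
    -- The agreement at `a` is new, since `f a` is `v` and not `b`. None is lost: `f` and `g`
    -- already differ at `b`, as `f b ≡ a` would force `b ≡ v`.
    closer : difference f g′ < difference f g
    closer = begin-strict
      difference f g′                                        <⟨ n<1+n _ ⟩
      1 + difference f g′                                    ≡⟨ cong (_+ difference f g′) (count-≟ a) ⟨
      count (λ x → x ≟ a) + difference f g′                  ≡⟨ ∑-distrib-+ (λ x → 𝟙 (x ≟ a)) _ ⟨
      sum (λ x → 𝟙 (x ≟ a) + 𝟙 (¬? (f x ≟ g′ x)))            ≤⟨ sum-mono pointwise ⟩
      difference f g                                         ∎
      where
      open ≤-Reasoning
      pointwise : ∀ x → 𝟙 (x ≟ a) + 𝟙 (¬? (f x ≟ g′ x)) ≤ 𝟙 (¬? (f x ≟ g x))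
      pointwise x with x ≟ a
      ... | yes refl = ≤-reflexive (trans (cong suc (𝟙-no (¬? (f a ≟ g′ a)) (λ ne → ne (trans fa (sym g′a)))))
                                          (sym (𝟙-yes (¬? (f a ≟ g a)) (λ eq → v≢b (trans (sym fa) eq)))))
      ... | no x≢a   = 𝟙-mono (¬? (f x ≟ g′ x)) (¬? (f x ≟ g x)) differs
        where
        differs : f x ≢ g′ x → f x ≢ g x
        differs ne eq with x ≟ v | x ≟ b
        ... | yes refl | _        = ne (sym g′v)
        ... | no _     | yes refl =
          v≢b (trans (sym fa) (trans (cong f (sym (trans eq gb))) (involutive (isMatching F) b)))
        ... | no x≢v   | no x≢b   = ne (trans eq (sym (g′-else x≢v x≢a x≢b)))
    -- Replacing `va` by `ab` frees `v` but covers `b`, so the vertex kept unmatched must not be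
    -- `b`.
    finish : ∀ {h} → Maximum E h → h v ≡ a → h b ≡ b → (h u ≡ u × u ≢ b ⊎ h w ≡ w × w ≢ b) →
             (∀ {x} → x ≢ v → x ≢ a → x ≢ b → h x ≡ x ⊎ h x ≡ f x ⊎ h x ≡ g x) →
             Exchange f g u v w
    finish {h} H hv hb huw within = h′ , slide-maximum H v≢a hv v≢b hb a-b , h′v ,
        Sum.map (uncurry free) (uncurry free) huw , within′
      where
      h′ = slide v a b h
      free : ∀ {x} → h x ≡ x → x ≢ b → h′ x ≡ x
      free = slide-unmatched (isMatching H) v≢a hv v≢b hb a-b
      h′v : h′ v ≡ v
      h′v = slide-v (isMatching H) v≢a hv v≢b hb a-b
      within′ : ∀ x → h′ x ≡ x ⊎ h′ x ≡ f x ⊎ h′ x ≡ g x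
      within′ x with x ≟ v | x ≟ a | x ≟ b
      ... | yes refl | _        | _        = inj₁ h′v
      ... | no _     | yes refl | _        = inj₂ (inj₂ (slide-a (isMatching H) v≢a hv v≢b hb a-b))
      ... | no _     | no _     | yes refl =
        inj₂ (inj₂ (trans (slide-b (isMatching H) v≢a hv v≢b hb a-b) (sym gb)))
      ... | no x≢v   | no x≢a   | no x≢b   =
        subst (λ y → y ≡ x ⊎ y ≡ f x ⊎ y ≡ g x)
          (sym (slide-else (isMatching H) v≢a hv v≢b hb a-b x≢v x≢a x≢b)) (within x≢v x≢a x≢b)
    exchanged : Exchange f g u v w
    exchanged with f b ≟ b
    -- Here `f` itself contains `va` and misses `b`; at most one of `u` and `w` is `b`.
    ... | yes fb = finish F refl fb one (λ _ _ _ → inj₂ (inj₁ refl))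
      where
      one : f u ≡ u × u ≢ b ⊎ f w ≡ w × w ≢ b
      one with u ≟ b
      ... | no u≢b = inj₁ (fu , u≢b)
      ... | yes refl = inj₂ (fw , u≢w ∘ sym)
    -- The induction runs with `g′` and its unmatched vertex `b`. Since `f` covers `b`, neither `u`
    -- nor `w` is `b`.
    ... | no fb≢b with exchange k F G′ (<-≤-trans closer diff) u≢w fu fw g′b
    ...   | h , H , hb , huw , within =
      finish H hv hb (Sum.map (λ hu → hu , λ { refl → fb≢b fu }) (λ hw → hw , λ { refl → fb≢b fw }) huw)
        (λ {x} x≢v x≢a x≢b → Sum.map₂ (Sum.map₂ (λ eq → trans eq (g′-else x≢v x≢a x≢b))) (within x))
      where
      -- Both `f` and `g′` match `a` to `v`, so only an unmatched `a` is to be excluded; then `ab`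
      -- would augment `h`.
      ha : h a ≡ v
      ha with within a
      ... | inj₁ ha = contradiction a-b (noAugmentingEdge H (ga≢a ∘ sym) ha hb)
      ... | inj₂ (inj₁ eq) = trans eq fa
      ... | inj₂ (inj₂ eq) = trans eq g′a
      hv : h v ≡ a
      hv = trans (cong h (sym ha)) (involutive (isMatching H) a)

  -- Contraposed, this is transitivity through a missable `v`: if no maximum matching misses `v`
  -- together with `u` or with `w`, none misses both `u` and `w`.
  gallai : ∀ {f g u v w} → Maximum E f → Maximum E g → u ≢ w → f u ≡ u → f w ≡ w → g v ≡ v →
           ∃[ h ] Maximum E h × h v ≡ v × (h u ≡ u ⊎ h w ≡ w)
  gallai F G u≢w fu fw gv with exchange _ F G ≤-refl u≢w fu fw gv
  ... | h , H , hv , huw , _ = h , H , hv , huw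

-- The equivalence relation of inseparability.

module _ {n} (E : Rel (Fin n) 0ℓ) where

  -- The classes of the proof belong to the negation, which `u ≢ v` makes reflexive.
  Separable : Rel (Fin n) 0ℓ
  Separable u v = u ≢ v × ∃[ g ] Maximum E g × g u ≡ u × g v ≡ v

  separable? : Decidable E → Decidable Separable
  separable? E? u v = ¬? (u ≟ v) ×-dec unmatchedPair? E? (proj₂ (maximum E?)) u v

  Missable : Fin n → Set
  Missable v = ∃[ g ] Maximum E g × g v ≡ v

  missable? : Decidable E → ∀ v → Dec (Missable v)
  missable? E? v = map′ (λ (g , G , gv , _) → g , G , gv) (λ (g , G , gv) → g , G , gv , gv)
                        (unmatchedPair? E? (proj₂ (maximum E?)) v v)

module _ {n} {E : Rel (Fin n) 0ℓ} (E-sym : Symmetric E) (missable : ∀ v → Missable E v) where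

  -- If some maximum matching missed `u` and `w`, Gallai's lemma would give one missing `v` with
  -- `u`, against the hypothesis, or `v` with `w`, leaving an augmenting edge.
  adjacent⇒inseparable : ∀ {u v w} → ¬ Separable E u v → E v w → ¬ Separable E u w
  adjacent⇒inseparable {u} {v} {w} u≈v e (u≢w , h , H , hu , hw) with v ≟ u | v ≟ w
  ... | yes refl | _        = noAugmentingEdge E-sym H u≢w hu hw e
  ... | no _     | yes refl = u≈v (u≢w , h , H , hu , hw)
  ... | no v≢u   | no v≢w   with missable v
  ...   | g , G , gv with gallai E-sym H G u≢w hu hw gv
  ...     | h′ , H′ , h′v , inj₁ h′u = u≈v (v≢u ∘ sym , h′ , H′ , h′u , h′v)
  ...     | h′ , H′ , h′v , inj₂ h′w = noAugmentingEdge E-sym H′ v≢w h′v h′w e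

  -- Two distinct such vertices would, by Gallai's lemma, let one of them be missed together with
  -- `v`.
  unmatched-unique : ∀ {f u v w} → Maximum E f → f u ≡ u → f w ≡ w →
                     ¬ Separable E u v → ¬ Separable E w v → u ≡ w
  unmatched-unique {f} {u} {v} {w} F fu fw u≈v w≈v = decidable-stable (u ≟ w) separate
    where
    separate : ¬ u ≢ w
    separate u≢w with u ≟ v | w ≟ v
    ... | yes refl | _        = w≈v (u≢w ∘ sym , f , F , fw , fu)
    ... | no _     | yes refl = u≈v (u≢w , f , F , fu , fw)
    ... | no u≢v   | no w≢v   with missable v
    ...   | g , G , gv with gallai E-sym F G u≢w fu fw gv
    ...     | h , H , hv , inj₁ hu = u≈v (u≢v , h , H , hu , hv)
    ...     | h , H , hv , inj₂ hw = w≈v (w≢v , h , H , hw , hv)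

-- Inequalities for the counting argument.

-- After exchanging the sums, each `w j` has a coefficient of at most one. It is applied to the
-- indicators of disjoint classes.
packing : ∀ {m n} (c : Fin m → Fin n → ℕ) → (∀ j → sum (λ i → c i j) ≤ 1) →
          ∀ w → sum (λ i → sum (λ j → c i j * w j)) ≤ sum w
packing c c≤1 w = begin
  sum (λ i → sum (λ j → c i j * w j))  ≡⟨ ∑-comm (λ i j → c i j * w j) ⟩
  sum (λ j → sum (λ i → c i j * w j))  ≡⟨ sum-cong-≗ (λ j → *-distribʳ-sum (w j) (λ i → c i j)) ⟨
  sum (λ j → sum (λ i → c i j) * w j)  ≤⟨ sum-mono (λ j → *-monoˡ-≤ (w j) (c≤1 j)) ⟩
  sum (λ j → 1 * w j)                  ≡⟨ sum-cong-≗ (λ j → *-identityˡ (w j)) ⟩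
  sum w                                ∎
  where open ≤-Reasoning

-- Divided by `d * suc d`, it reads 1 ≤ x/d + k/(d + 1): a class of `k` vertices with `x` edges into
-- `S` either has `d + 1` vertices or sends out at least k(d + 1 - k) ≥ d edges.
classWeight : ∀ d k x → 1 ≤ k → k * (suc d ∸ k) ≤ x → suc d * d ≤ suc d * x + d * k
classWeight d k@(suc k′) x _ k*≤x with k ≤? d
... | no  k≰d = ≤-trans (≤-trans (≤-reflexive (*-comm (suc d) d)) (*-monoʳ-≤ d (≰⇒> k≰d))) (m≤n+m _ _)
... | yes k≤d with m≤n⇒∃[o]m+o≡n k≤d
...   | j , refl = ≤-trans (*-monoʳ-≤ (suc (k + j)) (≤-trans small k*≤x)) (m≤m+n _ _)
  where
  small : k + j ≤ k * (suc (k + j) ∸ k)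
  small = begin
    k + j                    ≤⟨ +-monoʳ-≤ k (m≤m+n j (k′ * j)) ⟩
    k + k * j                ≡⟨ *-suc k j ⟨
    k * suc j                ≡⟨ cong (k *_) (trans (cong (_∸ k) (sym (+-suc k j))) (m+n∸m≡n k (suc j))) ⟨
    k * (suc (k + j) ∸ k)    ∎
    where open ≤-Reasoning

count-∈ : ∀ {n} (S : List (Fin n)) → count (_∈? S) ≤ length S
count-∈ {n} []      = ≤-reflexive (trans (sum-const n 0) (*-zeroʳ n))
count-∈     (x ∷ S) = begin
  count (_∈? (x ∷ S))                        ≤⟨ sum-mono pointwise ⟩
  sum (λ y → 𝟙 (y ≟ x) + 𝟙 (y ∈? S))         ≡⟨ ∑-distrib-+ (λ y → 𝟙 (y ≟ x)) _ ⟩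
  count (_≟ x) + count (_∈? S)               ≤⟨ +-mono-≤ (≤-reflexive (count-≟ x)) (count-∈ S) ⟩
  1 + length S                               ∎
  where
  open ≤-Reasoning
  pointwise : ∀ y → 𝟙 (y ∈? (x ∷ S)) ≤ 𝟙 (y ≟ x) + 𝟙 (y ∈? S)
  pointwise y with y ≟ x
  ... | yes _  = s≤s z≤n
  ... | no _   = ≤-refl

-- Vertex deletion.

module _ {n} (G : Graph n) where
  open Graph G

  -- Deleted vertices remain as isolated ones, so every matching of what is left counts them as
  -- unmatched.
  Delete : List (Fin n) → Rel (Fin n) 0ℓ
  Delete S u v = u ~ v × u ∉ S × v ∉ S

  delete? : ∀ S → Decidable (Delete S)
  delete? S u v = u ~? v ×-dec (¬? (u ∈? S) ×-dec ¬? (v ∈? S))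

  delete-sym : ∀ {S} → Symmetric (Delete S)
  delete-sym (u~v , u∉S , v∉S) = ~-sym u~v , v∉S , u∉S

  deleted-unmatched : ∀ {S f} → IsMatching (Delete S) f → ∀ {v} → v ∈ S → f v ≡ v
  deleted-unmatched {f = f} F {v} v∈S =
    decidable-stable (f v ≟ v) λ fv≢v → proj₁ (proj₂ (edge F v fv≢v)) v∈S

  delete-∷ : ∀ {S f v} → IsMatching (Delete (v ∷ S)) f → IsMatching (Delete S) f
  delete-∷ F = record
    { involutive = involutive F
    ; edge       = λ x fx≢x → let (e , x∉ , fx∉) = edge F x fx≢x in e , x∉ ∘ there , fx∉ ∘ there }

  count-~ : ∀ {d} → Regular d G → ∀ v → count (v ~?_) ≡ d
  count-~ regular v = trans (sym (length-filter-tabulate (v ~?_) id)) (regular v)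

  -- Counting unmatched vertices when every vertex is missable.

  module Counting {d} (regular : Regular d G) (S : List (Fin n)) {f} (F : Maximum (Delete S) f)
                  (missable : ∀ v → Missable (Delete S) v) where

    exits : Fin n → ℕ
    exits v = count (λ y → v ~? y ×-dec y ∈? S)

    -- Counted from the other end, exits are edges at vertices of `S`, with `d` edges at each.
    exits-sum : sum exits ≤ d * length S
    exits-sum = begin
      sum exits                                        ≡⟨ ∑-comm (λ v y → 𝟙 (v ~? y ×-dec y ∈? S)) ⟩
      sum (λ y → count (λ v → v ~? y ×-dec y ∈? S))    ≤⟨ sum-mono into ⟩
      sum (λ y → d * 𝟙 (y ∈? S))                       ≡⟨ *-distribˡ-sum d (λ y → 𝟙 (y ∈? S)) ⟨
      d * count (_∈? S)                                ≤⟨ *-monoʳ-≤ d (count-∈ S) ⟩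
      d * length S                                     ∎
      where
      open ≤-Reasoning
      into : ∀ y → count (λ v → v ~? y ×-dec y ∈? S) ≤ d * 𝟙 (y ∈? S)
      into y with y ∈? S
      ... | yes y∈S = begin
        count (λ v → v ~? y ×-dec yes y∈S)
          ≤⟨ sum-mono (λ v → 𝟙-mono (v ~? y ×-dec yes y∈S) (y ~? v) (~-sym ∘ proj₁)) ⟩
        count (y ~?_)                       ≡⟨ count-~ regular y ⟩
        d                                   ≡⟨ *-identityʳ d ⟨
        d * 1                               ∎
      ... | no y∉S = begin
        count (λ v → v ~? y ×-dec no y∉S)   ≡⟨ sum-cong-≗ (λ v → 𝟙-no (v ~? y ×-dec no y∉S) (y∉S ∘ proj₂)) ⟩
        sum {n} (λ _ → 0)                   ≡⟨ trans (sum-const n 0) (*-zeroʳ n) ⟩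
        0                                   ≤⟨ z≤n ⟩
        d * 0                               ∎

    -- A root stands for its class, which by `unmatched-unique` contains no other root.
    Root : Fin n → Set
    Root u = f u ≡ u × u ∉ S

    root? : ∀ u → Dec (Root u)
    root? u = f u ≟ u ×-dec ¬? (u ∈? S)

    inClass? : ∀ u v → Dec (¬ Separable (Delete S) u v)
    inClass? u v = ¬? (separable? (Delete S) (delete? S) u v)

    classSize : Fin n → ℕ
    classSize u = count (inClass? u)

    -- Of `v` and its `d` neighbours, each neighbour in `S` is an exit, and all the others lie in
    -- the class of `u`.
    exits-lower : ∀ {u v} → Root u → ¬ Separable (Delete S) u v → suc d ≤ exits v + classSize u
    exits-lower {u} {v} (fu , u∉S) u≈v = begin
      suc d                                                      ≡⟨ +-comm 1 d ⟩
      d + 1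
        ≡⟨ cong₂ _+_ (count-~ regular v) (count-≟ v) ⟨
      count (v ~?_) + count (_≟ v)                               ≡⟨ ∑-distrib-+ (λ y → 𝟙 (v ~? y)) _ ⟨
      sum (λ y → 𝟙 (v ~? y) + 𝟙 (y ≟ v))                         ≤⟨ sum-mono pointwise ⟩
      sum (λ y → 𝟙 (v ~? y ×-dec y ∈? S) + 𝟙 (inClass? u y))
        ≡⟨ ∑-distrib-+ (λ y → 𝟙 (v ~? y ×-dec y ∈? S)) _ ⟩
      exits v + classSize u                                      ∎
      where
      open ≤-Reasoning
      -- `f` misses `u` and all of `S`, so a deleted `v` would be separable from `u`.
      v∉S : v ∉ S
      v∉S v∈S = u≈v ((λ { refl → u∉S v∈S }) , f , F , fu , deleted-unmatched (isMatching F) v∈S)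
      pointwise : ∀ y → 𝟙 (v ~? y) + 𝟙 (y ≟ v) ≤ 𝟙 (v ~? y ×-dec y ∈? S) + 𝟙 (inClass? u y)
      pointwise y with y ≟ v
      ... | yes refl = begin
        𝟙 (v ~? v) + 1
          ≡⟨ cong₂ _+_ (𝟙-no (v ~? v) (~-irrefl v)) (sym (𝟙-yes (inClass? u v) u≈v)) ⟩
        𝟙 (inClass? u v)                               ≤⟨ m≤n+m _ _ ⟩
        𝟙 (v ~? v ×-dec v ∈? S) + 𝟙 (inClass? u v)     ∎
      ... | no _ with v ~? y | y ∈? S
      ...   | no _    | _       = z≤n
      ...   | yes _   | yes _   = s≤s z≤n
      ...   | yes v~y | no y∉S  =
        ≤-reflexive (sym (𝟙-yes (inClass? u y) (adjacent⇒inseparable delete-sym missable u≈v (v~y , v∉S , y∉S))))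

    -- Summing `exits-lower` over the class gives the product that `classWeight` asks for.
    root-weight : ∀ u → Root u →
                  suc d * d ≤ suc d * sum (λ v → 𝟙 (inClass? u v) * exits v) + d * classSize u
    root-weight u root = classWeight d (classSize u) _ (1≤count (inClass? u) u (λ (u≢u , _) → u≢u refl)) (begin
      classSize u * (suc d ∸ classSize u)
        ≡⟨ *-distribʳ-sum _ (λ v → 𝟙 (inClass? u v)) ⟩
      sum (λ v → 𝟙 (inClass? u v) * (suc d ∸ classSize u))       ≤⟨ sum-mono pointwise ⟩
      sum (λ v → 𝟙 (inClass? u v) * exits v)                     ∎)
      where
      open ≤-Reasoning
      pointwise : ∀ v → 𝟙 (inClass? u v) * (suc d ∸ classSize u) ≤ 𝟙 (inClass? u v) * exits v
      pointwise v = bound (inClass? u v)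
        where
        bound : (c? : Dec (¬ Separable (Delete S) u v)) → 𝟙 c? * (suc d ∸ classSize u) ≤ 𝟙 c? * exits v
        bound (no _)    = z≤n
        bound (yes u≈v) = *-monoʳ-≤ 1
          (m≤n+o⇒m∸n≤o (suc d) (classSize u) (subst (suc d ≤_) (+-comm (exits v) _) (exits-lower root u≈v)))

    rootClass? : ∀ u v → Dec (Root u × ¬ Separable (Delete S) u v)
    rootClass? u v = root? u ×-dec inClass? u v

    classes-disjoint : ∀ v → sum (λ u → 𝟙 (rootClass? u v)) ≤ 1
    classes-disjoint v = count-unique (λ u → rootClass? u v)
      λ ((fu , _) , u≈v) ((fw , _) , w≈v) → unmatched-unique delete-sym missable F fu fw u≈v w≈v

    -- Taking the decision as argument lets `root-bound` split on it. The factor 1 gives both sums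
    -- the shape of `packing`.
    rootExits rootSize : ∀ {u} → Dec (Root u) → ℕ
    rootExits {u} r? = sum (λ v → 𝟙 (r? ×-dec inClass? u v) * exits v)
    rootSize  {u} r? = sum (λ v → 𝟙 (r? ×-dec inClass? u v) * 1)

    root-bound : ∀ {u} (r? : Dec (Root u)) → 𝟙 r? * (suc d * d) ≤ suc d * rootExits r? + d * rootSize r?
    root-bound     (no _)         = z≤n
    root-bound {u} r?@(yes root)  = begin
      1 * (suc d * d)                             ≡⟨ *-identityˡ _ ⟩
      suc d * d                                   ≤⟨ root-weight u root ⟩
      suc d * rootExits r? + d * classSize u
        ≡⟨ cong (λ k → suc d * rootExits r? + d * k) (sum-cong-≗ (λ v → *-identityʳ (𝟙 (inClass? u v)))) ⟨
      suc d * rootExits r? + d * rootSize r?      ∎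
      where open ≤-Reasoning

    -- Summed over all roots, the disjoint classes use at most `d * length S` exits and `n`
    -- vertices; a common factor `d` cancels.
    roots-bound : 1 ≤ d → suc d * count root? ≤ suc d * length S + n
    roots-bound (s≤s _) = *-cancelˡ-≤ d (begin
      d * (suc d * count root?)
        ≡⟨ solve 2 (λ d r → d :* ((con 1 :+ d) :* r) := r :* ((con 1 :+ d) :* d)) refl d (count root?) ⟩
      count root? * (suc d * d)
        ≡⟨ *-distribʳ-sum (suc d * d) (λ u → 𝟙 (root? u)) ⟩
      sum (λ u → 𝟙 (root? u) * (suc d * d))
        ≤⟨ sum-mono (root-bound ∘ root?) ⟩
      sum (λ u → suc d * rootExits (root? u) + d * rootSize (root? u))
        ≡⟨ ∑-distrib-+ (λ u → suc d * rootExits (root? u)) _ ⟩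
      sum (λ u → suc d * rootExits (root? u)) + sum (λ u → d * rootSize (root? u))
        ≡⟨ cong₂ _+_ (*-distribˡ-sum (suc d) (rootExits ∘ root?)) (*-distribˡ-sum d (rootSize ∘ root?)) ⟨
      suc d * sum (rootExits ∘ root?) + d * sum (rootSize ∘ root?)
        ≤⟨ +-mono-≤ (*-monoʳ-≤ (suc d) (≤-trans (packed exits) exits-sum)) (*-monoʳ-≤ d (packed (λ _ → 1))) ⟩
      suc d * (d * length S) + d * sum {n} (λ _ → 1)
        ≡⟨ cong (λ k → suc d * (d * length S) + d * k) (trans (sum-const n 1) (*-identityʳ n)) ⟩
      suc d * (d * length S) + d * n
        ≡⟨ solve 3 (λ d s n → (con 1 :+ d) :* (d :* s) :+ d :* n := d :* ((con 1 :+ d) :* s :+ n))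
             refl d (length S) n ⟩
      d * (suc d * length S + n)                           ∎)
      where
      open ≤-Reasoning
      open ℕ.+-*-Solver
      packed : ∀ w → sum (λ u → sum (λ v → 𝟙 (rootClass? u v) * w v)) ≤ sum w
      packed = packing (λ u v → 𝟙 (rootClass? u v)) classes-disjoint

    unmatched≤roots : unmatched f ≤ count root? + length S
    unmatched≤roots = begin
      unmatched f                                ≤⟨ sum-mono pointwise ⟩
      sum (λ u → 𝟙 (root? u) + 𝟙 (u ∈? S))       ≡⟨ ∑-distrib-+ (λ u → 𝟙 (root? u)) _ ⟩
      count root? + count (_∈? S)                ≤⟨ +-monoʳ-≤ _ (count-∈ S) ⟩
      count root? + length S                     ∎
      where
      open ≤-Reasoning
      pointwise : ∀ u → 𝟙 (f u ≟ u) ≤ 𝟙 (root? u) + 𝟙 (u ∈? S)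
      pointwise u with f u ≟ u | u ∈? S
      ... | no _  | _     = z≤n
      ... | yes _ | yes _ = ≤-refl
      ... | yes _ | no _  = ≤-refl

  -- The bound on the deficiency.

  module _ {d} (1≤d : 1 ≤ d) (regular : Regular d G) where

    -- Each vertex put into S is covered by every maximum matching of what was
    -- left, so it adds 2 to the number of unmatched vertices.
    deficiency-delete : ∀ k S → n < k + length S → ∀ {f} → Maximum (Delete S) f →
                  ∀ {m} → m + 2 * length S ≤ unmatched f → suc d * m ≤ n
    -- The fuel cannot run out: `2 * length S` is at most `unmatched f`, hence at most `n`.
    deficiency-delete zero S n<S {f} F {m} m+2S≤ = contradiction n<S (≤⇒≯ (begin
      length S                   ≤⟨ m≤m+n _ _ ⟩
      2 * length S               ≤⟨ m≤n+m _ m ⟩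
      m + 2 * length S           ≤⟨ m+2S≤ ⟩
      unmatched f                ≤⟨ m≤m+n _ _ ⟩
      unmatched f + 2 * pairs f  ≡⟨ unmatched+2pairs (isMatching F) ⟩
      n                          ∎))
      where open ≤-Reasoning
    deficiency-delete (suc k) S n<k+S {f} F {m} m+2S≤ with Fin.all? (missable? (Delete S) (delete? S))
    -- At most `length S` of the unmatched vertices are deleted ones, so at least `m + length S` are
    -- roots.
    ... | yes missable = +-cancelʳ-≤ (suc d * length S) _ _ (begin
      suc d * m + suc d * length S   ≡⟨ *-distribˡ-+ (suc d) m _ ⟨
      suc d * (m + length S)         ≤⟨ *-monoʳ-≤ (suc d) m+S≤ ⟩
      suc d * count root?            ≤⟨ roots-bound 1≤d ⟩
      suc d * length S + n           ≡⟨ +-comm _ n ⟩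
      n + suc d * length S           ∎)
      where
      open ≤-Reasoning
      open ℕ.+-*-Solver
      open Counting regular S F missable
      m+S≤ : m + length S ≤ count root?
      m+S≤ = +-cancelʳ-≤ (length S) _ _ (begin
        m + length S + length S    ≡⟨ solve 2 (λ m s → m :+ s :+ s := m :+ con 2 :* s) refl m (length S) ⟩
        m + 2 * length S           ≤⟨ m+2S≤ ⟩
        unmatched f                ≤⟨ unmatched≤roots ⟩
        count root? + length S     ∎)
    ... | no ¬missable with Fin.¬∀⟶∃¬ n _ (missable? (Delete S) (delete? S)) ¬missable
    ...   | v , covered with maximum (delete? (v ∷ S))
    -- `g` is also a matching from before the deletion of `v`, and it misses the covered vertex `v`.
    -- So it is not maximum there, and parity makes the loss two.
    ...     | g , G = deficiency-delete k (v ∷ S) (subst (n <_) (sym (+-suc k _)) n<k+S) G (begin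
      m + 2 * suc (length S)
        ≡⟨ solve 2 (λ m s → m :+ con 2 :* (con 1 :+ s) := con 2 :+ (m :+ con 2 :* s)) refl m (length S) ⟩
      2 + (m + 2 * length S)       ≤⟨ +-monoʳ-≤ 2 m+2S≤ ⟩
      2 + unmatched f
        ≤⟨ unmatched-gap (isMatching F) G′ (≰⇒> λ g≤f → covered (g , ≤-maximum F G′ g≤f , gv)) ⟩
      unmatched g                  ∎)
      where
      open ≤-Reasoning
      open ℕ.+-*-Solver
      G′ : IsMatching (Delete S) g
      G′ = delete-∷ (isMatching G)
      gv : g v ≡ v
      gv = deleted-unmatched (isMatching G) (here refl)

    deficiency : ∀ {f} → Maximum _~_ f → suc d * unmatched f ≤ n
    deficiency {f} F with maximum (delete? [])
    ... | g , G = deficiency-delete (suc n) [] (s≤s (m≤m+n n 0)) G (begin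
      unmatched f + 0  ≡⟨ +-identityʳ _ ⟩
      unmatched f      ≤⟨ least F G′ ⟩
      unmatched g      ∎)
      where
      open ≤-Reasoning
      G′ : IsMatching _~_ g
      G′ = record { involutive = involutive (isMatching G) ; edge = λ x → proj₁ ∘ edge (isMatching G) x }

  -- Translation between edge lists and involutions.

  -- The last component shows the ends of the next edge to be unmatched, as `link` requires.
  toInvolution : ∀ es → All (uncurry _~_) es → AllPairs VertexDisjoint es →
                 ∃[ f ] IsMatching _~_ f × unmatched f + 2 * length es ≡ n ×
                        (∀ {x} → All (λ (a , b) → x ≢ a × x ≢ b) es → f x ≡ x)
  toInvolution [] [] [] = id , id-isMatching ,
    (begin
      unmatched {n} id + 0  ≡⟨ +-identityʳ _ ⟩
      unmatched {n} id      ≡⟨ sum-cong-≗ (λ (x : Fin n) → 𝟙-yes (x ≟ x) refl) ⟩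
      sum {n} (λ _ → 1)     ≡⟨ trans (sum-const n 1) (*-identityʳ n) ⟩
      n                     ∎) , λ _ → refl
    where open ≡-Reasoning
  toInvolution ((a , b) ∷ es) (a~b ∷ areEdges) (ab# ∷ disjoint) with toInvolution es areEdges disjoint
  ... | f , F , size , free = link a b f , link-isMatching ~-sym F a≢b fa fb a~b ,
    (begin
      unmatched (link a b f) + 2 * suc (length es)
        ≡⟨ solve 2 (λ u l → u :+ con 2 :* (con 1 :+ l) := con 2 :+ u :+ con 2 :* l)
             refl (unmatched (link a b f)) (length es) ⟩
      2 + unmatched (link a b f) + 2 * length es
        ≡⟨ cong (_+ 2 * length es) (unmatched-link ~-sym F a≢b fa fb a~b) ⟩
      unmatched f + 2 * length es                     ≡⟨ size ⟩
      n                                               ∎) ,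
    λ { ((x≢a , x≢b) ∷ x#) → trans (link-else ~-sym F a≢b fa fb a~b x≢a x≢b) (free x#) }
    where
    open ≡-Reasoning
    open ℕ.+-*-Solver
    a≢b : a ≢ b
    a≢b refl = ~-irrefl a a~b
    fa : f a ≡ a
    fa = free (All.map (λ (a≢c , a≢d , _) → a≢c , a≢d) ab#)
    fb : f b ≡ b
    fb = free (All.map (λ (_ , _ , b≢c , b≢d) → b≢c , b≢d) ab#)

  -- Each edge is listed from its smaller end, so the length is `pairs f`.
  toMatching : ∀ {f} → IsMatching _~_ f → ∃[ M ] Matching.size {G = G} M ≡ pairs f
  toMatching {f} F = record
    { edges    = List.map (λ v → v , f v) (filter lower? (allFin n))
    ; areEdges = All.map⁺ (All.map (λ {v} v<fv → edge F v (λ eq → <⇒≢ v<fv (cong Fin.toℕ (sym eq)))) lower)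
    ; disjoint = AllPairs.map⁺ (discharge lower (AllPairs.filter⁺ lower? (AllPairs.tabulate⁺ apart)))
    } , trans (List.length-map _ (filter lower? (allFin n))) (length-filter-tabulate lower? id)
    where
    lower? : ∀ v → Dec (v Fin.< f v)
    lower? v = v Fin.<? f v
    lower : All (λ v → v Fin.< f v) (filter lower? (allFin n))
    lower = All.all-filter lower? (allFin n)
    apart : ∀ {v w} → v ≢ w → v Fin.< f v → w Fin.< f w → VertexDisjoint (v , f v) (w , f w)
    apart {v} {w} v≢w v<fv w<fw =
      v≢w ,
      (λ { refl → <-asym w<fw (subst (f w Fin.<_) (involutive F w) v<fv) }) ,
      (λ { refl → <-asym v<fv (subst (f v Fin.<_) (involutive F v) w<fw) }) ,
      (λ eq → v≢w (trans (sym (involutive F v)) (trans (cong f eq) (involutive F w))))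
    -- `apart` needs both vertices to have passed the filter, which is known only for the filtered
    -- list.
    discharge : ∀ {P : Fin n → Set} {R : Rel (Fin n) 0ℓ} {xs} →
                All P xs → AllPairs (λ x y → P x → P y → R x y) xs → AllPairs R xs
    discharge []       []       = []
    discharge (p ∷ ps) (r ∷ rs) = All.zipWith (λ (r , q) → r p q) (r , ps) ∷ discharge ps rs

  maximumMatching : ∀ {f} → Maximum _~_ f →
                    ∃[ M ] IsMaximum {G = G} M × unmatched f + 2 * Matching.size M ≡ n
  maximumMatching {f} F with toMatching (isMatching F)
  ... | M , size≡ = M , (λ M′ → subst (_ ≤_) (sym size≡) (bound M′)) ,
                    trans (cong (λ k → unmatched f + 2 * k) size≡) (unmatched+2pairs (isMatching F))
    where
    bound : ∀ M′ → Matching.size {G = G} M′ ≤ pairs f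
    bound M′ with toInvolution (Matching.edges M′) (Matching.areEdges M′) (Matching.disjoint M′)
    ... | g , G′ , size , _ = ≮⇒≥ λ p<s →
      <⇒≢ (+-mono-≤-< (least F G′) (*-monoʳ-< 2 p<s)) (trans (unmatched+2pairs (isMatching F)) (sym size))

-- Rational estimates for the logarithm and the error term.

open import Data.Integer using (+_)

toℚᵘ-/ : ∀ m k → ℚ.toℚᵘ (+ m / suc k) ℚᵘ.≃ mkℚᵘ (+ m) k
toℚᵘ-/ m k = ℚ.toℚᵘ-fromℚᵘ (mkℚᵘ (+ m) k)

-- The first term is already `½`, and the others are nonnegative.
½≤logLowerSum : ∀ m → ½ ℚ.≤ logLowerSum (suc (suc m)) 1
½≤logLowerSum m = begin
  ½                            ≡⟨ ℚ.+-identityʳ ½ ⟨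
  ½ ℚ.+ 0ℚ                     ≤⟨ ℚ.+-monoʳ-≤ ½ (nonNegative (λ i → + 1 / suc (1 + suc i)) 0≤1/ (m * 1)) ⟩
  logLowerSum (suc (suc m)) 1  ∎
  where
  open ℚ.≤-Reasoning
  0≤1/ : ∀ i → 0ℚ ℚ.≤ + 1 / suc (1 + suc i)
  0≤1/ i = ℚ.nonNegative⁻¹ _ {{ℚ.normalize-nonNeg 1 (suc (1 + suc i))}}
  nonNegative : ∀ f → (∀ i → 0ℚ ℚ.≤ f i) → ∀ k → 0ℚ ℚ.≤ foldr ℚ._+_ 0ℚ (applyUpTo f k)
  nonNegative f 0≤f zero    = ℚ.≤-refl
  nonNegative f 0≤f (suc k) = ℚ.+-mono-≤ (0≤f 0) (nonNegative (λ i → f (suc i)) (λ i → 0≤f (suc i)) k)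

-- The lower sum with `s = 1` gives `K * ½ ≤ d`.
log-bound : ∀ K n d → 2 ≤ n → K *log n ≤ ℕ→ℚ d → K ≤ d * 2
log-bound K (suc zero) d (s≤s ()) _
log-bound K (suc (suc n)) d _ Klog≤d = ℤ.drop‿+≤+ (begin
    + K                        ≡⟨ trans (ℤ.*-identityʳ _) (ℤ.*-identityʳ (+ K)) ⟨
    + K ℤ.* + 1 ℤ.* + 1        ≤⟨ ℚᵘ.drop-*≤* cross ⟩
    + d ℤ.* + 2                ≡⟨ ℤ.pos-* d 2 ⟨
    + (d * 2)                  ∎)
  where
  open ℤ.≤-Reasoning
  cross : mkℚᵘ (+ K) 0 ℚᵘ.* mkℚᵘ (+ 1) 1 ℚᵘ.≤ mkℚᵘ (+ d) 0
  cross = ℚᵘ.≤-respˡ-≃ (ℚᵘ.≃-trans (ℚ.toℚᵘ-homo-* (ℕ→ℚ K) ½) (ℚᵘ.*-congʳ (toℚᵘ-/ K 0)))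
            (ℚᵘ.≤-respʳ-≃ (toℚᵘ-/ d 0) (ℚ.toℚᵘ-mono-≤
              (ℚ.≤-trans (ℚ.*-monoˡ-≤-nonNeg (ℕ→ℚ K) {{ℚ.normalize-nonNeg K 1}} (½≤logLowerSum n)) (Klog≤d 1))))

-- The error term: `u` unmatched vertices leave (n - u)/2 edges, which is 1/2 - u/(2n) per vertex.
-- Order zero gets a default value.
halfRatio : ℕ → ℕ → ℚ
halfRatio u zero    = 0ℚ
halfRatio u (suc n) = + u / (2 * suc n)

halfRatio-size : ∀ u s n → u + 2 * s ≡ n → ℕ→ℚ s ≡ (½ ℚ.- halfRatio u n) ℚ.* ℕ→ℚ n
halfRatio-size zero zero zero _ = refl
halfRatio-size u s (suc n) eq =
  ℚ.toℚᵘ-injective (ℚᵘ.≃-trans (toℚᵘ-/ s 0) (ℚᵘ.≃-sym (ℚᵘ.≃-trans expand (ℚᵘ.*≡* cross))))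
  where
  r = halfRatio u (suc n)
  -- `mkℚᵘ` takes the denominator less one; here the denominator is `2 * suc n`.
  k = n + suc (n + 0)
  expand : ℚ.toℚᵘ ((½ ℚ.- r) ℚ.* ℕ→ℚ (suc n)) ℚᵘ.≃ (mkℚᵘ (+ 1) 1 ℚᵘ.- mkℚᵘ (+ u) k) ℚᵘ.* mkℚᵘ (+ suc n) 0
  expand = ℚᵘ.≃-trans (ℚ.toℚᵘ-homo-* (½ ℚ.- r) (ℕ→ℚ (suc n)))
    (ℚᵘ.*-cong (ℚᵘ.≃-trans (ℚ.toℚᵘ-homo-+ ½ (ℚ.- r))
                 (ℚᵘ.+-congʳ (mkℚᵘ (+ 1) 1) (ℚᵘ.≃-trans (ℚ.toℚᵘ-homo‿- r) (ℚᵘ.-‿cong (toℚᵘ-/ u k)))))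
               (toℚᵘ-/ (suc n) 0))
  N≡ : + suc n ≡ + u ℤ.+ + 2 ℤ.* + s
  N≡ = trans (cong +_ (sym eq)) (cong (λ t → + u ℤ.+ t) (ℤ.pos-* 2 s))
  cross : (+ 1 ℤ.* + (2 * suc n) ℤ.+ ℤ.- + u ℤ.* + 2) ℤ.* + suc n ℤ.* + 1 ≡ + s ℤ.* + (2 * (2 * suc n) * 1)
  cross = begin
    (+ 1 ℤ.* + (2 * suc n) ℤ.+ ℤ.- + u ℤ.* + 2) ℤ.* + suc n ℤ.* + 1
      ≡⟨ cong (λ N → (+ 1 ℤ.* N ℤ.+ ℤ.- + u ℤ.* + 2) ℤ.* + suc n ℤ.* + 1)
              (trans (ℤ.pos-* 2 (suc n)) (cong (+ 2 ℤ.*_) N≡)) ⟩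
    (+ 1 ℤ.* (+ 2 ℤ.* (+ u ℤ.+ + 2 ℤ.* + s)) ℤ.+ ℤ.- + u ℤ.* + 2) ℤ.* + suc n ℤ.* + 1
      ≡⟨ solve 3 (λ u s N → (con (+ 1) :* (con (+ 2) :* (u :+ con (+ 2) :* s)) :+ :- u :* con (+ 2)) :* N :* con (+ 1)
                              := s :* (con (+ 2) :* (con (+ 2) :* N))) refl (+ u) (+ s) (+ suc n) ⟩
    + s ℤ.* (+ 2 ℤ.* (+ 2 ℤ.* + suc n))
      ≡⟨ cong (+ s ℤ.*_) (trans (cong +_ (*-identityʳ _))
           (trans (ℤ.pos-* 2 (2 * suc n)) (cong (+ 2 ℤ.*_) (ℤ.pos-* 2 (suc n))))) ⟨
    + s ℤ.* + (2 * (2 * suc n) * 1) ∎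
    where
    open ≡-Reasoning
    open ℤ.+-*-Solver

-- The numerator of `ε` is at least one, so it suffices that `u * ↧ₙ ε ≤ 2 * (d * u) < 2 * n`.
halfRatio-small : ∀ u n d ε → 1 ≤ n → 0ℚ ℚ.< ε → suc d * u ≤ n → ↧ₙ ε ≤ d * 2 →
                  ℚ.∣ halfRatio u n ∣ ℚ.< ε
halfRatio-small u (suc n) d ε@(mkℚ (+ suc p) q _) _ 0<ε bound K≤2d =
  subst (ℚ._< ε) (sym (ℚ.0≤p⇒∣p∣≡p (ℚ.nonNegative⁻¹ _ {{ℚ.normalize-nonNeg u (2 * suc n)}})))
    (ℚ.toℚᵘ-cancel-< (ℚᵘ.<-respˡ-≃ (ℚᵘ.≃-sym (toℚᵘ-/ u (n + suc (n + 0))))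
      (ℚᵘ.*<* (subst₂ ℤ._<_ (ℤ.pos-* u (suc q)) (ℤ.pos-* (suc p) (2 * suc n)) (ℤ.+<+ cross)))))
  where
  open ≤-Reasoning
  cross : u * suc q < suc p * (2 * suc n)
  cross = begin-strict
    u * suc q           ≤⟨ *-monoʳ-≤ u K≤2d ⟩
    u * (d * 2)         ≡⟨ trans (sym (*-assoc u d 2)) (trans (*-comm (u * d) 2) (cong (2 *_) (*-comm u d))) ⟩
    2 * (d * u)         <⟨ *-monoʳ-< 2 (du<n u bound) ⟩
    2 * suc n           ≤⟨ m≤m+n _ _ ⟩
    suc p * (2 * suc n) ∎
    where
    -- Strict because of the extra summand `u` if `u` is positive, and of the positive order
    -- otherwise.
    du<n : ∀ u → suc d * u ≤ suc n → d * u < suc n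
    du<n zero    _ = subst (_< suc n) (sym (*-zeroʳ d)) (s≤s z≤n)
    du<n (suc u) b = <-≤-trans (m<n+m (d * suc u) (s≤s z≤n)) b
halfRatio-small u (suc n) d (mkℚ (+ zero) q _) _ (ℚ.*<* (ℤ.+<+ ())) _ _
halfRatio-small u (suc n) d (mkℚ ℤ.-[1+ p ] q _) _ (ℚ.*<* ()) _ _

theorem1p3 : (d : ℕ → ℕ) →
    (∀ n → 0 ℕ.< d n) →
    RatioToLog→∞Along (Admissible d) d →
    (G : ∀ n → Graph n) →
    (∀ n → Admissible d n → Regular (d n) (G n)) →
    ∃[ o ] Tends→0Along (Admissible d) o ×
    (∀ n → Admissible d n →
    ∃[ M ] IsMaximum {G = G n} M ×
    ℕ→ℚ (Matching.size M) ≡ (½ ℚ.- o n) ℚ.* ℕ→ℚ n)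
theorem1p3 d 0<d d/log→∞ G regular = o , tends , matching
  where
  mate : ∀ n → ∃ (Maximum (Graph._~_ (G n)))
  mate n = maximum (Graph._~?_ (G n))
  o : ℕ → ℚ
  o n = halfRatio (unmatched (proj₁ (mate n))) n
  tends : Tends→0Along (Admissible d) o
  -- Taking the denominator of `ε` for `K` yields `↧ₙ ε ≤ d n * 2` as soon as `n` is also at least
  -- 2.
  tends ε 0<ε with d/log→∞ (↧ₙ ε)
  ... | N , large = 2 ℕ.⊔ N , λ n N≤n even →
    let 2≤n = m⊔n≤o⇒m≤o 2 N N≤n in
    halfRatio-small _ n (d n) ε (≤-trans (s≤s z≤n) 2≤n) 0<ε
      (deficiency (G n) (0<d n) (regular n even) (proj₂ (mate n)))
      (log-bound (↧ₙ ε) n (d n) 2≤n (large n (m⊔n≤o⇒n≤o 2 N N≤n) even))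
  matching : ∀ n → Admissible d n →
             ∃[ M ] IsMaximum {G = G n} M × ℕ→ℚ (Matching.size M) ≡ (½ ℚ.- o n) ℚ.* ℕ→ℚ n
  matching n _ with maximumMatching (G n) (proj₂ (mate n))
  ... | M , isMaximum , size = M , isMaximum , halfRatio-size _ (Matching.size M) n size
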